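{- Let $G$ be a connected non-bipartite graph and $\Gamma=(G,\sigma)$ a signed graph on $G$. Then $\Gamma\in\mathbb{NFS}_1(G)$ if and only if $\Gamma$ is switching isomorphic to a signed graph $\Gamma^a$ or to a signed graph $\Gamma^b$ whose adjacency matrix has, respectively, the form $$A(\Gamma^a)=\begin{pmatrix} B & X \\ X & -B \end{pmatrix},\qquad A(\Gamma^b)=\begin{pmatrix} B & Y \\ -Y & -B \end{pmatrix},$$ where $B$, $X$, $Y$ are square matrices of the same size with entries in $\{0,1,-1\}$, $B=B^\top$ has zero diagonal, $X=X^\top$, and $Y=-Y^\top$.
   Context: Graphs are finite and simple. A signed graph $\Gamma=(G,\sigma)$ on $G$ is $G$ with a function $\sigma:E(G)\to\{+1,-1\}$; its adjacency matrix has $(u,v)$-entry $\sigma(uv)$ if $uv\in E(G)$ and $0$ otherwise. Switching $\Gamma$ with respect to $U\subseteq V(G)$ reverses the signs of all edges between $U$ and $V(G)\setminus U$. $\Gamma\simeq\Gamma'$ (switching isomorphic) means $\Gamma$ is isomorphic, by a sign-preserving graph isomorphism, to a switching of $\Gamma'$. $\Gamma$ is sign-symmetric if $\Gamma\simeq-\Gamma=(G,-\sigma)$. The sign of a cycle is the product of the signs of its edges. A weak automorphism of $\Gamma$ is a $\varphi\in Aut(G)$ with $\sigma(\varphi(C))=-\sigma(C)$ for every odd cycle $C$ of $G$ and $\sigma(\varphi(C))=\sigma(C)$ for every even cycle $C$. It is principal (a PWA) if it has the smallest order among all weak automorphisms of $\Gamma$. $\mathbb{S}_1(G)$ is the set of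 sign-symmetric signed graphs on $G$ having a principal weak automorphism of order $2$. For such a $\varphi$ put $F=\{v\in V(G)\mid\varphi(v)=v\}$. $\mathbb{NFS}_1(G)$ is the set of $\Gamma\in\mathbb{S}_1(G)$ with $F=\emptyset$, i.e. having a principal weak automorphism of order $2$ without fixed vertices. -}

module Defs where

open import Data.Bool.Base using (Bool; false; T; _xor_; if_then_else_)
open import Data.Bool.Properties using (T?; xor-comm)
open import Data.Fin.Base using (Fin)
open import Data.Fin.Permutation using (Permutation; _⟨$⟩ʳ_)
open import Data.Fin.Subset using (Subset; _∈_; _∉_)
open import Data.Integer.Base as ℤ using (ℤ; 0ℤ; 1ℤ; -1ℤ; _◃_)
open import Data.List.Base as List using (List; []; _∷_)
open import Data.List.Relation.Unary.Unique.Propositional using (Unique)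
open import Data.List.Relation.Unary.Unique.Propositional.Properties using (map⁺)
open import Data.Nat.Base using (ℕ; zero; suc; _+_; _≤_; _<_)
open import Data.Nat.Divisibility using (_∣_; _∤_)
open import Data.Nat.GeneralisedArithmetic using (fold)
open import Data.Product.Base using (Σ; ∃; _×_)
open import Data.Sign.Base as Sign using (Sign; opposite)
open import Data.Sum.Base using (_⊎_)
open import Data.Vec.Base using (lookup)
open import Data.Vec.Functional using (Vector; _++_; zipWith; transpose)
open import Function.Bundles using (Injection)
open import Function.Properties.Inverse using (↔⇒↣)
open import Level using (0ℓ)
open import Relation.Binary.Core using (Rel)
open import Relation.Binary.Construct.Closure.ReflexiveTransitive using (Star; ε; _◅_; gmap)
open import Relation.Binary.PropositionalEquality using (_≡_; refl; sym; trans; cong; subst)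
open import Relation.Nullary using (¬_; yes; no)
open import Relation.Unary using (Pred; Empty)

record Graph (n : ℕ) : Set where
  field
    adj        : Fin n → Fin n → Bool
    adj-sym    : ∀ u v → adj u v ≡ adj v u
    adj-irrefl : ∀ v → adj v v ≡ false

open Graph public

Edge : ∀ {n} → Graph n → Fin n → Fin n → Set
Edge G u v = T (adj G u v)

Walk : ∀ {n} → Graph n → Fin n → Fin n → Set
Walk G = Star (Edge G)

-- The empty graph counts as connected here; it is bipartite, so nothing
-- about connected non-bipartite graphs depends on this.
Connected : ∀ {n} → Graph n → Set
Connected G = ∀ u v → Walk G u v

Bipartite : ∀ {n} → Graph n → Set
Bipartite {n} G = Σ (Subset n) λ U → ∀ u v → Edge G u v →
  (u ∈ U × v ∉ U) ⊎ (u ∉ U × v ∈ U)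

record GraphIso {n m} (G : Graph n) (H : Graph m) : Set where
  field
    perm     : Permutation n m
    adj-pres : ∀ u v → adj G u v ≡ adj H (perm ⟨$⟩ʳ u) (perm ⟨$⟩ʳ v)

  apply : Fin n → Fin m
  apply = perm ⟨$⟩ʳ_

  applyEdge : ∀ {u v} → Edge G u v → Edge H (apply u) (apply v)
  applyEdge {u} {v} = subst T (adj-pres u v)

open GraphIso public

Aut : ∀ {n} → Graph n → Set
Aut G = GraphIso G G

length : ∀ {V : Set} {R : Rel V 0ℓ} {u v} → Star R u v → ℕ
length ε       = 0
length (_ ◅ w) = suc (length w)

-- All vertices of the walk, in order, except the final one.
vertices : ∀ {V : Set} {R : Rel V 0ℓ} {u v} → Star R u v → List V
vertices ε                = []
vertices (_◅_ {i = u} _ w) = u ∷ vertices w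

-- A cycle, given with a choice of starting vertex and direction; every
-- cycle of G is represented, once for each such choice.
record Cycle {n} (G : Graph n) : Set where
  field
    base   : Fin n
    walk   : Walk G base base
    simple : Unique (vertices walk)
    long   : 3 ≤ length walk

open Cycle public

applyWalk : ∀ {n m} {G : Graph n} {H : Graph m} (φ : GraphIso G H) {u v} →
            Walk G u v → Walk H (apply φ u) (apply φ v)
applyWalk φ = gmap (apply φ) (applyEdge φ)

length-applyWalk : ∀ {n m} {G : Graph n} {H : Graph m} (φ : GraphIso G H) {u v}
                   (w : Walk G u v) → length (applyWalk φ w) ≡ length w
length-applyWalk φ ε       = refl
length-applyWalk φ (_ ◅ w) = cong suc (length-applyWalk φ w)

vertices-applyWalk : ∀ {n m} {G : Graph n} {H : Graph m} (φ : GraphIso G H) {u v}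
                     (w : Walk G u v) →
                     vertices (applyWalk φ w) ≡ List.map (apply φ) (vertices w)
vertices-applyWalk φ ε       = refl
vertices-applyWalk φ (_ ◅ w) = cong (_ ∷_) (vertices-applyWalk φ w)

applyCycle : ∀ {n m} {G : Graph n} {H : Graph m} → GraphIso G H → Cycle G → Cycle H
applyCycle φ C = record
  { base   = apply φ (base C)
  ; walk   = applyWalk φ (walk C)
  ; simple = subst Unique (sym (vertices-applyWalk φ (walk C)))
                   (map⁺ (Injection.injective (↔⇒↣ (perm φ))) (simple C))
  ; long   = subst (3 ≤_) (sym (length-applyWalk φ (walk C))) (long C)
  }

EvenCycle OddCycle : ∀ {n} {G : Graph n} → Cycle G → Set
EvenCycle C = 2 ∣ length (walk C)
OddCycle  C = 2 ∤ length (walk C)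

record SignedGraph {n} (G : Graph n) : Set where
  field
    σ     : ∀ u v → Edge G u v → Sign
    σ-sym : ∀ u v (e : Edge G u v) (e′ : Edge G v u) → σ u v e ≡ σ v u e′

open SignedGraph public

Matrix : ℕ → Set
Matrix n = Vector (Vector ℤ n) n

adjacencyMatrix : ∀ {n} {G : Graph n} → SignedGraph G → Matrix n
adjacencyMatrix {G = G} Γ u v with T? (adj G u v)
... | yes e = σ Γ u v e ◃ 1
... | no  _ = 0ℤ

negate : ∀ {n} {G : Graph n} → SignedGraph G → SignedGraph G
negate Γ = record
  { σ     = λ u v e → opposite (σ Γ u v e)
  ; σ-sym = λ u v e e′ → cong opposite (σ-sym Γ u v e e′)
  }

flipIf : Bool → Sign → Sign
flipIf b s = if b then opposite s else s

switch : ∀ {n} {G : Graph n} → Subset n → SignedGraph G → SignedGraph G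
switch U Γ = record
  { σ     = λ u v e → flipIf (lookup U u xor lookup U v) (σ Γ u v e)
  ; σ-sym = λ u v e e′ →
      trans (cong (flipIf (lookup U u xor lookup U v)) (σ-sym Γ u v e e′))
            (cong (λ b → flipIf b (σ Γ v u e′)) (xor-comm (lookup U u) (lookup U v)))
  }

record SignedIso {n m} {G : Graph n} {H : Graph m}
                 (Γ : SignedGraph G) (Δ : SignedGraph H) : Set where
  field
    iso       : GraphIso G H
    sign-pres : ∀ u v (e : Edge G u v) →
                σ Γ u v e ≡ σ Δ (apply iso u) (apply iso v) (applyEdge iso e)

open SignedIso public

infix 4 _≃_

_≃_ : ∀ {n m} {G : Graph n} {H : Graph m} → SignedGraph G → SignedGraph H → Set
Γ ≃ Δ = ∃ λ U → SignedIso Γ (switch U Δ)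

SignSymmetric : ∀ {n} {G : Graph n} → SignedGraph G → Set
SignSymmetric Γ = Γ ≃ negate Γ

walkSign : ∀ {n} {G : Graph n} → SignedGraph G → ∀ {u v} → Walk G u v → Sign
walkSign Γ ε                        = Sign.+
walkSign Γ (_◅_ {i = u} {j = v} e w) = σ Γ u v e Sign.* walkSign Γ w

cycleSign : ∀ {n} {G : Graph n} → SignedGraph G → Cycle G → Sign
cycleSign Γ C = walkSign Γ (walk C)

record WeakAut {n} {G : Graph n} (Γ : SignedGraph G) (φ : Aut G) : Set where
  field
    odd-cycles  : ∀ (C : Cycle G) → OddCycle C →
                  cycleSign Γ (applyCycle φ C) ≡ opposite (cycleSign Γ C)
    even-cycles : ∀ (C : Cycle G) → EvenCycle C →
                  cycleSign Γ (applyCycle φ C) ≡ cycleSign Γ C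

PowerIsId : ∀ {n} {G : Graph n} → Aut G → ℕ → Set
PowerIsId φ k = ∀ v → fold v (apply φ) k ≡ v

record HasOrder {n} {G : Graph n} (φ : Aut G) (k : ℕ) : Set where
  field
    positive : 0 < k
    power    : PowerIsId φ k
    least    : ∀ j → 0 < j → PowerIsId φ j → k ≤ j

record Principal {n} {G : Graph n} (Γ : SignedGraph G) (φ : Aut G) : Set where
  field
    weak     : WeakAut Γ φ
    smallest : ∀ (ψ : Aut G) → WeakAut Γ ψ →
               ∀ k l → HasOrder φ k → HasOrder ψ l → k ≤ l

FixedVertices : ∀ {n} {G : Graph n} → Aut G → Pred (Fin n) 0ℓ
FixedVertices φ v = apply φ v ≡ v

𝕊₁ : ∀ {n} (G : Graph n) → Pred (SignedGraph G) 0ℓ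
𝕊₁ G Γ = SignSymmetric Γ × ∃ λ (φ : Aut G) → Principal Γ φ × HasOrder φ 2

-- The automorphism without fixed vertices is the one witnessing
-- membership in 𝕊₁ G.
ℕ𝔽𝕊₁ : ∀ {n} (G : Graph n) → Pred (SignedGraph G) 0ℓ
ℕ𝔽𝕊₁ G Γ = SignSymmetric Γ ×
  ∃ λ (φ : Aut G) → Principal Γ φ × HasOrder φ 2 × Empty (FixedVertices φ)

infix 4 _≋_
infix 8 -ᴹ_

_≋_ : ∀ {n} → Matrix n → Matrix n → Set
A ≋ B = ∀ i j → A i j ≡ B i j

-ᴹ_ : ∀ {n} → Matrix n → Matrix n
(-ᴹ A) i j = ℤ.- A i j

block : ∀ {m} (A B C D : Matrix m) → Matrix (m + m)
block A B C D = zipWith _++_ A B ++ zipWith _++_ C D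

Entries01-1 : ∀ {n} → Matrix n → Set
Entries01-1 A = ∀ i j → A i j ≡ 0ℤ ⊎ A i j ≡ 1ℤ ⊎ A i j ≡ -1ℤ

ZeroDiagonal : ∀ {n} → Matrix n → Set
ZeroDiagonal A = ∀ i → A i i ≡ 0ℤ

Symmetricᴹ SkewSymmetricᴹ : ∀ {n} → Matrix n → Set
Symmetricᴹ     A = A ≋ transpose A
SkewSymmetricᴹ A = A ≋ -ᴹ transpose A

record Formᵃ {m} {H : Graph (m + m)} (Γ : SignedGraph H) : Set where
  field
    B X       : Matrix m
    B-entries : Entries01-1 B
    X-entries : Entries01-1 X
    B-sym     : Symmetricᴹ B
    B-diag    : ZeroDiagonal B
    X-sym     : Symmetricᴹ X
    form      : adjacencyMatrix Γ ≋ block B X X (-ᴹ B)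

record Formᵇ {m} {H : Graph (m + m)} (Γ : SignedGraph H) : Set where
  field
    B Y       : Matrix m
    B-entries : Entries01-1 B
    Y-entries : Entries01-1 Y
    B-sym     : Symmetricᴹ B
    B-diag    : ZeroDiagonal B
    Y-skew    : SkewSymmetricᴹ Y
    form      : adjacencyMatrix Γ ≋ block B Y (-ᴹ Y) (-ᴹ B)

-- A weak automorphism φ multiplies the sign of every cycle C by (−1)^|C|, so the pullback of Γ along
-- φ has the same cycle signs as −Γ and, G being connected, is a switching of −Γ by some U.  If φ is
-- an involution, applying this twice shows that c = U v + U (φ v) does not depend on v.  Listing one
-- vertex per φ-orbit first and their images second, φ becomes the exchange of the two halves, and a
-- further switching inside the second half makes it negate all signs up to the constant c, which
-- selects form a or form b.  Conversely the exchange of the halves of a block form is a fixed-point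
-- free negating involution; it is principal because the identity is not a weak automorphism of a
-- non-bipartite graph.
module Submission where

open import Defs
open import Data.Nat.Base using (ℕ; _+_)
open import Data.Product.Base using (Σ; _×_)
open import Data.Sum.Base using (_⊎_)
open import Function.Bundles using (_⇔_)
open import Relation.Nullary using (¬_)
open import Relation.Unary using (_∈_)

open import Algebra.Properties.CommutativeSemigroup as CommutativeSemigroupProperties using ()
open import Data.Bool.Base using (Bool; true; false; T; _xor_; if_then_else_)
open import Data.Bool.Properties using (T?; T-irrelevant; xor-same; xor-identityʳ)
open import Data.Bool.Solver using (module xor-∧-Solver)
open import Data.Empty using (⊥-elim)
open import Data.Fin.Base as Fin using (Fin; zero; suc; _↑ˡ_; _↑ʳ_; splitAt)
open import Data.Fin.Permutation
  using (Permutation; permutation; _⟨$⟩ʳ_; _⟨$⟩ˡ_; inverseˡ; inverseʳ; flip; _∘ₚ_)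
import Data.Fin.Properties as Fin
open import Data.Fin.Subset as Subset using (Subset)
open import Data.Integer.Base as ℤ using (ℤ; 0ℤ; _◃_)
import Data.Integer.Properties as ℤ
open import Data.List.Base as List using (List; _∷_)
import Data.List.Membership.DecPropositional as DecMembership
open import Data.List.Membership.Propositional as List using ()
open import Data.List.Membership.Propositional.Properties
  using (∈-lookup; ∈-allFin; ∈-filter⁺; ∈-filter⁻)
open import Data.List.Relation.Unary.All as All using ()
open import Data.List.Relation.Unary.All.Properties using (¬Any⇒All¬)
open import Data.List.Relation.Unary.AllPairs using ([]; _∷_)
open import Data.List.Relation.Unary.Any as Any using (here; there)
open import Data.List.Relation.Unary.Any.Properties using (lookup-index)
open import Data.List.Relation.Unary.Unique.Propositional using (Unique)
open import Data.List.Relation.Unary.Unique.Propositional.Properties using (filter⁺; allFin⁺)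
open import Data.Nat.Base using (zero; suc; _*_; _≤_; _<_; z≤n; s≤s)
open import Data.Nat.Divisibility using (_∣_; _∤_; divides; _∣?_; ∣-refl; ∣m∣n⇒∣m+n; _∣0)
open import Data.Nat.GeneralisedArithmetic using (fold)
open import Data.Nat.Induction using (<-wellFounded)
open import Data.Nat.Properties using (≤-refl; ≤-trans; m≤n⇒m≤1+n)
open import Data.Product.Base using (∃; _,_; proj₁; proj₂)
open import Data.Sign.Base as Sign using (Sign; opposite)
import Data.Sign.Properties as Sign
open import Data.Sum.Base as Sum using (inj₁; inj₂)
open import Data.Vec.Base as Vec using (lookup; tabulate; replicate)
import Data.Vec.Functional as Functional
import Data.Vec.Functional.Properties as Functional
open import Data.Vec.Properties
  using (lookup∘tabulate; lookup-++ˡ; lookup-++ʳ; lookup-replicate; lookup⇒[]=; []=⇒lookup)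
open import Function.Bundles using (mk⇔)
open import Function.Construct.Composition using (_↔-∘_)
open import Function.Construct.Symmetry using (↔-sym)
open import Function.Related.TypeIsomorphisms using (⊎-comm)
open import Induction.WellFounded using (Acc; acc)
open import Relation.Binary.Construct.Closure.ReflexiveTransitive using (ε; _◅_; _◅◅_)
open import Relation.Binary.Definitions using (tri<; tri≈; tri>)
open import Relation.Binary.PropositionalEquality
open import Relation.Nullary using (Dec; yes; no)
open import Relation.Nullary.Decidable using (decidable-stable)
open import Relation.Nullary.Negation using (contradiction)

private variable
  n m k : ℕ

-- Proofs of `T` are unique, so a sign depends on the endpoints alone. Edges can therefore be moved
-- along equalities of vertices that are only propositional.
σ-cong : {G : Graph n} (Γ : SignedGraph G) {u u′ v v′ : Fin n} (e : Edge G u v) (e′ : Edge G u′ v′) →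
         u ≡ u′ → v ≡ v′ → σ Γ u v e ≡ σ Γ u′ v′ e′
σ-cong Γ e e′ refl refl = cong (σ Γ _ _) (T-irrelevant e e′)

-- Arithmetic of sign flips

flipIf-xor : ∀ a b s → flipIf a (flipIf b s) ≡ flipIf (a xor b) s
flipIf-xor false b     s = refl
flipIf-xor true  false s = refl
flipIf-xor true  true  s = Sign.opposite-involutive s

flipIf-opposite : ∀ b s → flipIf b (opposite s) ≡ opposite (flipIf b s)
flipIf-opposite false s = refl
flipIf-opposite true  s = refl

flipIf-* : ∀ a b s t → flipIf a s Sign.* flipIf b t ≡ flipIf (a xor b) (s Sign.* t)
flipIf-* false false s      t = refl
flipIf-* false true  Sign.- t = refl
flipIf-* false true  Sign.+ t = refl
flipIf-* true  false Sign.- t = sym (Sign.opposite-involutive t)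
flipIf-* true  false Sign.+ t = refl
flipIf-* true  true  Sign.- t = refl
flipIf-* true  true  Sign.+ t = Sign.opposite-involutive t

-- Signs of walks

module _ {G : Graph n} (Γ : SignedGraph G) where

  walkSign-◅◅ : ∀ {u v w} (p : Walk G u v) (q : Walk G v w) →
                walkSign Γ (p ◅◅ q) ≡ walkSign Γ p Sign.* walkSign Γ q
  walkSign-◅◅ ε       q = refl
  walkSign-◅◅ (e ◅ p) q =
    trans (cong (σ Γ _ _ e Sign.*_) (walkSign-◅◅ p q)) (sym (Sign.*-assoc (σ Γ _ _ e) _ _))

  -- The bit of an interior vertex enters with both edges at that vertex and cancels, so only the
  -- end bits survive. On closed walks these cancel too: switching preserves cycle signs.
  walkSign-switch : ∀ U {u v} (w : Walk G u v) →
                    walkSign (switch U Γ) w ≡ flipIf (lookup U u xor lookup U v) (walkSign Γ w)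
  walkSign-switch U {u} ε = cong (λ b → flipIf b Sign.+) (sym (xor-same (lookup U u)))
  walkSign-switch U {u} {v} (_◅_ {j = x} e w) = begin
    flipIf (a xor b) (σ Γ u x e) Sign.* walkSign (switch U Γ) w
      ≡⟨ cong (flipIf (a xor b) (σ Γ u x e) Sign.*_) (walkSign-switch U w) ⟩
    flipIf (a xor b) (σ Γ u x e) Sign.* flipIf (b xor c) (walkSign Γ w)
      ≡⟨ flipIf-* (a xor b) (b xor c) _ _ ⟩
    flipIf ((a xor b) xor (b xor c)) (walkSign Γ (e ◅ w))
      ≡⟨ cong (λ d → flipIf d (walkSign Γ (e ◅ w))) (telescope a b c) ⟩
    flipIf (a xor c) (walkSign Γ (e ◅ w)) ∎
    where
    open ≡-Reasoning
    a = lookup U u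
    b = lookup U x
    c = lookup U v
    open xor-∧-Solver
    telescope : ∀ a b c → (a xor b) xor (b xor c) ≡ a xor c
    telescope = solve 3 (λ a b c → (a :+ b) :+ (b :+ c) := a :+ c) refl

  -- Iterating `opposite` stands for the factor (-1) to the length; `fold-opposite-even` and
  -- `fold-opposite-odd` evaluate it by parity.
  walkSign-negate : ∀ {u v} (w : Walk G u v) →
                    walkSign (negate Γ) w ≡ fold (walkSign Γ w) opposite (length w)
  walkSign-negate ε = refl
  walkSign-negate (_◅_ {i = u} {j = v} e w) =
    trans (cong (opposite (σ Γ u v e) Sign.*_) (walkSign-negate w))
          (shift (σ Γ u v e) (walkSign Γ w) (length w))
    where
    opposite-*ˡ : ∀ s t → opposite s Sign.* t ≡ opposite (s Sign.* t)
    opposite-*ˡ Sign.- t = sym (Sign.opposite-involutive t)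
    opposite-*ˡ Sign.+ t = refl
    opposite-*ʳ : ∀ s t → s Sign.* opposite t ≡ opposite (s Sign.* t)
    opposite-*ʳ Sign.- t = refl
    opposite-*ʳ Sign.+ t = refl
    shift : ∀ s t k → opposite s Sign.* fold t opposite k ≡ opposite (fold (s Sign.* t) opposite k)
    shift s t zero    = opposite-*ˡ s t
    shift s t (suc k) = trans (opposite-*ʳ (opposite s) _) (cong opposite (shift s t k))

walkSign-iso : {G : Graph n} {H : Graph m} {Γ : SignedGraph G} {Δ : SignedGraph H}
               (f : SignedIso Γ Δ) → ∀ {u v} (w : Walk G u v) →
               walkSign Γ w ≡ walkSign Δ (applyWalk (iso f) w)
walkSign-iso f ε       = refl
walkSign-iso f (e ◅ w) = cong₂ Sign._*_ (sign-pres f _ _ e) (walkSign-iso f w)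

fold-opposite-even : 2 ∣ k → ∀ s → fold s opposite k ≡ s
fold-opposite-even (divides q refl) s = go q
  where
  go : ∀ q → fold s opposite (q * 2) ≡ s
  go zero    = refl
  go (suc q) = trans (Sign.opposite-involutive _) (go q)

fold-opposite-odd : ∀ k → 2 ∤ k → ∀ s → fold s opposite k ≡ opposite s
fold-opposite-odd zero          odd s = ⊥-elim (odd (2 ∣0))
fold-opposite-odd (suc zero)    odd s = refl
fold-opposite-odd (suc (suc k)) odd s =
  trans (Sign.opposite-involutive _) (fold-opposite-odd k (λ 2∣k → odd (∣m∣n⇒∣m+n ∣-refl 2∣k)) s)

-- Harary's balance theorem

module _ {G : Graph n} (Γ : SignedGraph G) where

  private
    -- The bound on `p` is strict because `vertices` omits the final vertex, so at least one edge
    -- remains for `q`.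
    cutAt : ∀ {u v x} (w : Walk G u v) → x List.∈ vertices w →
            Σ (Walk G u x) λ p → Σ (Walk G x v) λ q →
            length p < length w × length q ≤ length w ×
            walkSign Γ w ≡ walkSign Γ p Sign.* walkSign Γ q
    cutAt w@(_ ◅ _) (here refl) = ε , w , s≤s z≤n , ≤-refl , refl
    cutAt (e ◅ w) (there x∈w) with cutAt w x∈w
    ... | p , q , p< , q≤ , eq = e ◅ p , q , s≤s p< , m≤n⇒m≤1+n q≤ ,
      trans (cong (σ Γ _ _ e Sign.*_) eq) (sym (Sign.*-assoc (σ Γ _ _ e) _ _))

    -- Both pieces are strictly shorter than `w`, which drives the recursion in `closed-positive`:
    -- if `w` is closed, so is `rest`.
    Detour : ∀ {u v} → Walk G u v → Set
    Detour {u} {v} w = ∃ λ x → Σ (Walk G x x) λ loop → Σ (Walk G u v) λ rest →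
      length loop < length w × length rest < length w ×
      walkSign Γ w ≡ walkSign Γ loop Sign.* walkSign Γ rest

    simple-or-detour : ∀ {u v} (w : Walk G u v) → Unique (vertices w) ⊎ Detour w
    simple-or-detour ε = inj₁ []
    simple-or-detour (_◅_ {i = u} {j = y} e w) with simple-or-detour w
    ... | inj₂ (x , loop , rest , l< , r< , eq) =
      inj₂ (x , loop , e ◅ rest , m≤n⇒m≤1+n l< , s≤s r< ,
        trans (cong (s Sign.*_) eq) (swapˡ s (walkSign Γ loop) (walkSign Γ rest)))
      where
      s = σ Γ u y e
      swapˡ : ∀ a b c → a Sign.* (b Sign.* c) ≡ b Sign.* (a Sign.* c)
      swapˡ a b c = trans (sym (Sign.*-assoc a b c))
                   (trans (cong (Sign._* c) (Sign.*-comm a b)) (Sign.*-assoc b a c))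
    ... | inj₁ unique with u ∈? vertices w
      where open DecMembership (Fin._≟_ {n})
    ...   | no u∉w = inj₁ (¬Any⇒All¬ _ u∉w ∷ unique)
    ...   | yes u∈w with cutAt w u∈w
    ...     | p , q , p< , q≤ , eq = inj₂ (u , e ◅ p , q , s≤s p< , s≤s q≤ ,
      trans (cong (σ Γ u y e Sign.*_) eq) (sym (Sign.*-assoc (σ Γ u y e) _ _)))

  -- Strong induction on the length. A closed walk with a repeated vertex splits into two shorter
  -- closed walks whose signs multiply to its own; one without repetition is a cycle, or too short
  -- to be one and treated by hand.
  closed-positive : (∀ (C : Cycle G) → cycleSign Γ C ≡ Sign.+) →
                    ∀ {u} (w : Walk G u u) → walkSign Γ w ≡ Sign.+
  closed-positive positive w = go w (<-wellFounded _)
    where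
    short : ∀ {u} (w : Walk G u u) → Unique (vertices w) → walkSign Γ w ≡ Sign.+
    short ε _ = refl
    short (_◅_ {i = u} e ε) _ = ⊥-elim (subst T (adj-irrefl G u) e)
    -- One edge traversed back and forth is not a `Cycle`; its sign is a square.
    short (_◅_ {i = u} {j = v} e (e′ ◅ ε)) _ = begin
      s Sign.* (σ Γ v u e′ Sign.* Sign.+) ≡⟨ cong (s Sign.*_) (Sign.*-identityʳ (σ Γ v u e′)) ⟩
      s Sign.* σ Γ v u e′                 ≡⟨ cong (s Sign.*_) (σ-sym Γ v u e′ e) ⟩
      s Sign.* s                          ≡⟨ Sign.s*s≡+ s ⟩
      Sign.+                              ∎
      where
      open ≡-Reasoning
      s = σ Γ u v e
    short w@(_ ◅ _ ◅ _ ◅ _) unique =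
      positive record { base = _ ; walk = w ; simple = unique ; long = s≤s (s≤s (s≤s z≤n)) }

    go : ∀ {u} (w : Walk G u u) → Acc _<_ (length w) → walkSign Γ w ≡ Sign.+
    go w (acc rec) with simple-or-detour w
    ... | inj₁ unique = short w unique
    ... | inj₂ (_ , loop , rest , l< , r< , eq) =
      trans eq (cong₂ Sign._*_ (go loop (rec l<)) (go rest (rec r<)))

isNegative : Sign → Bool
isNegative Sign.- = true
isNegative Sign.+ = false

-- Vertex `zero` serves as root, and `U` collects the vertices whose chosen walk to the root is
-- negative. For an edge from `u` to `v`, the walk from `u` to the root and the detour through `v`
-- close up with the same walk from the root to `u`, so they have equal signs and the sign of the
-- edge is the quotient of the two chosen signs.
balanced : {G : Graph n} (Γ : SignedGraph G) → Connected G →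
           (∀ (C : Cycle G) → cycleSign Γ C ≡ Sign.+) →
           ∃ λ U → ∀ u v (e : Edge G u v) → σ Γ u v e ≡ flipIf (lookup U u xor lookup U v) Sign.+
balanced {zero}          Γ connected positive = Vec.[] , λ ()
balanced {suc n} {G = G} Γ connected positive = tabulate toRoot , σ-toRoot
  where
  toRoot : Fin (suc n) → Bool
  toRoot v = isNegative (walkSign Γ (connected v zero))

  -- Here `a` is the sign of the common walk from the root, `s` that of the edge, and `b` and `d`
  -- those of the chosen walks from `v` and `u`. The hypotheses refute all other sign patterns.
  flipIf-isNegative : ∀ a s b d → a Sign.* (s Sign.* b) ≡ Sign.+ → a Sign.* d ≡ Sign.+ →
                      s ≡ flipIf (isNegative d xor isNegative b) Sign.+
  flipIf-isNegative Sign.- Sign.- Sign.+ Sign.- _ _ = refl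
  flipIf-isNegative Sign.- Sign.+ Sign.- Sign.- _ _ = refl
  flipIf-isNegative Sign.+ Sign.- Sign.- Sign.+ _ _ = refl
  flipIf-isNegative Sign.+ Sign.+ Sign.+ Sign.+ _ _ = refl

  closed : ∀ {v} (p : Walk G zero v) (q : Walk G v zero) →
           walkSign Γ p Sign.* walkSign Γ q ≡ Sign.+
  closed p q = trans (sym (walkSign-◅◅ Γ p q)) (closed-positive Γ positive (p ◅◅ q))

  σ-toRoot : ∀ u v (e : Edge G u v) →
             σ Γ u v e ≡ flipIf (lookup (tabulate toRoot) u xor lookup (tabulate toRoot) v) Sign.+
  σ-toRoot u v e rewrite lookup∘tabulate toRoot u | lookup∘tabulate toRoot v =
    flipIf-isNegative (walkSign Γ (connected zero u)) _ _ _
      (closed (connected zero u) (e ◅ connected v zero))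
      (closed (connected zero u) (connected u zero))

infixl 7 _·_

-- The edgewise product records where two signatures disagree. It is balanced when their cycle signs
-- coincide, and a set balancing it switches one signature into the other.
_·_ : {G : Graph n} → SignedGraph G → SignedGraph G → SignedGraph G
Γ · Δ = record
  { σ     = λ u v e → σ Γ u v e Sign.* σ Δ u v e
  ; σ-sym = λ u v e e′ → cong₂ Sign._*_ (σ-sym Γ u v e e′) (σ-sym Δ u v e e′)
  }

walkSign-· : {G : Graph n} (Γ Δ : SignedGraph G) → ∀ {u v} (w : Walk G u v) →
             walkSign (Γ · Δ) w ≡ walkSign Γ w Sign.* walkSign Δ w
walkSign-· Γ Δ ε       = refl
walkSign-· Γ Δ (e ◅ w) =
  trans (cong (σ Γ _ _ e Sign.* σ Δ _ _ e Sign.*_) (walkSign-· Γ Δ w))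
        (interchange (σ Γ _ _ e) (σ Δ _ _ e) (walkSign Γ w) (walkSign Δ w))
  where open CommutativeSemigroupProperties Sign.*-commutativeSemigroup

-- Zaslavsky: the cycle signs determine the switching class.
equal-cycleSigns⇒switching :
  {G : Graph n} (Γ Δ : SignedGraph G) → Connected G →
  (∀ (C : Cycle G) → cycleSign Γ C ≡ cycleSign Δ C) →
  ∃ λ U → ∀ u v (e : Edge G u v) → σ Γ u v e ≡ σ (switch U Δ) u v e
equal-cycleSigns⇒switching {G = G} Γ Δ connected equal with balanced (Γ · Δ) connected positive
  where
  positive : ∀ (C : Cycle G) → cycleSign (Γ · Δ) C ≡ Sign.+
  positive C = begin
    cycleSign (Γ · Δ) C                ≡⟨ walkSign-· Γ Δ (walk C) ⟩
    cycleSign Γ C Sign.* cycleSign Δ C ≡⟨ cong (Sign._* cycleSign Δ C) (equal C) ⟩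
    cycleSign Δ C Sign.* cycleSign Δ C ≡⟨ Sign.s*s≡+ (cycleSign Δ C) ⟩
    Sign.+                             ∎
    where open ≡-Reasoning
... | U , bal = U , λ u v e → divide (σ Γ u v e) (σ Δ u v e) _ (bal u v e)
  where
  divide : ∀ s t b → s Sign.* t ≡ flipIf b Sign.+ → s ≡ flipIf b t
  divide Sign.- Sign.- false eq = refl
  divide Sign.- Sign.+ true  eq = refl
  divide Sign.+ Sign.- true  eq = refl
  divide Sign.+ Sign.+ false eq = refl

-- If all cycles are even, the all-negative signature has only positive cycles. It is then balanced,
-- and the balancing set is a colour class of a bipartition. The negative formulation avoids a
-- search for an odd cycle and suffices for the contradiction drawn from it.
nonbipartite⇒oddCycle : (G : Graph n) → Connected G → ¬ Bipartite G →
                        ¬ (∀ (C : Cycle G) → 2 ∣ length (walk C))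
nonbipartite⇒oddCycle G connected nonbip even =
  nonbip (proj₁ colouring , λ u v e → separated (proj₁ colouring) u v (proj₂ colouring u v e))
  where
  positive : SignedGraph G
  positive = record { σ = λ _ _ _ → Sign.+ ; σ-sym = λ _ _ _ _ → refl }

  walkSign-positive : ∀ {u v} (w : Walk G u v) → walkSign positive w ≡ Sign.+
  walkSign-positive ε       = refl
  walkSign-positive (_ ◅ w) = walkSign-positive w

  colouring = balanced (negate positive) connected λ C →
    trans (walkSign-negate positive (walk C))
          (trans (fold-opposite-even (even C) _) (walkSign-positive (walk C)))

  true≢false : true ≢ false
  true≢false ()

  separated : ∀ (U : Subset _) u v → Sign.- ≡ flipIf (lookup U u xor lookup U v) Sign.+ →
              (u Subset.∈ U × v Subset.∉ U) ⊎ (u Subset.∉ U × v Subset.∈ U)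
  separated U u v eq with lookup U u in eqᵘ | lookup U v in eqᵛ
  ... | true  | false =
    inj₁ (lookup⇒[]= u U eqᵘ , λ v∈U → true≢false (trans (sym ([]=⇒lookup v∈U)) eqᵛ))
  ... | false | true  =
    inj₂ ((λ u∈U → true≢false (trans (sym ([]=⇒lookup u∈U)) eqᵘ)) , lookup⇒[]= v U eqᵛ)

-- Weak automorphisms

pullback : {G : Graph n} {H : Graph m} → GraphIso G H → SignedGraph H → SignedGraph G
pullback φ Δ = record
  { σ     = λ u v e → σ Δ (apply φ u) (apply φ v) (applyEdge φ e)
  ; σ-sym = λ u v e e′ → σ-sym Δ (apply φ u) (apply φ v) (applyEdge φ e) (applyEdge φ e′)
  }

pullback-iso : {G : Graph n} {H : Graph m} (φ : GraphIso G H) (Δ : SignedGraph H) →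
               SignedIso (pullback φ Δ) Δ
pullback-iso φ Δ = record { iso = φ ; sign-pres = λ _ _ _ → refl }

module _ {G : Graph n} (Γ : SignedGraph G) where

  -- In `negate (pullback φ Γ)` the parity factor from `negate` cancels the one that `φ` introduces,
  -- so cycle signs agree with those of `Γ`. The equation `iso f ≡ φ` lets properties of `φ` pass to
  -- `f`.
  weakAut⇒negating : Connected G → ∀ (φ : Aut G) → WeakAut Γ φ →
                     ∃ λ U → Σ (SignedIso Γ (switch U (negate Γ))) λ f → iso f ≡ φ
  weakAut⇒negating connected φ weak
    with equal-cycleSigns⇒switching Γ (negate (pullback φ Γ)) connected equal
    where
    open WeakAut weak
    image-sign : ∀ C → cycleSign (pullback φ Γ) C ≡ cycleSign Γ (applyCycle φ C)
    image-sign C = walkSign-iso (pullback-iso φ Γ) (walk C)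
    equal : ∀ (C : Cycle G) → cycleSign Γ C ≡ cycleSign (negate (pullback φ Γ)) C
    equal C with 2 ∣? length (walk C)
    ... | yes 2∣ = sym (begin
      cycleSign (negate (pullback φ Γ)) C ≡⟨ walkSign-negate (pullback φ Γ) (walk C) ⟩
      _                                   ≡⟨ fold-opposite-even 2∣ _ ⟩
      cycleSign (pullback φ Γ) C          ≡⟨ image-sign C ⟩
      _                                   ≡⟨ even-cycles C 2∣ ⟩
      cycleSign Γ C                       ∎)
      where open ≡-Reasoning
    ... | no 2∤ = sym (begin
      cycleSign (negate (pullback φ Γ)) C   ≡⟨ walkSign-negate (pullback φ Γ) (walk C) ⟩
      _                                     ≡⟨ fold-opposite-odd (length (walk C)) 2∤ _ ⟩
      opposite (cycleSign (pullback φ Γ) C) ≡⟨ cong opposite (trans (image-sign C) (odd-cycles C 2∤)) ⟩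
      opposite (opposite (cycleSign Γ C))   ≡⟨ Sign.opposite-involutive _ ⟩
      cycleSign Γ C                         ∎)
      where open ≡-Reasoning
  ... | U , eq = U′ , record { iso = φ ; sign-pres = pres } , refl
    where
    -- `U` switches on the source of `φ`, while a `SignedIso` to a switching needs a set on the
    -- target; hence `U` is transported along `φ`.
    U′ = tabulate (λ v → lookup U (perm φ ⟨$⟩ˡ v))
    U′-apply : ∀ v → lookup U′ (apply φ v) ≡ lookup U v
    U′-apply v = trans (lookup∘tabulate _ (apply φ v)) (cong (lookup U) (inverseˡ (perm φ)))
    pres : ∀ u v e → σ Γ u v e ≡ σ (switch U′ (negate Γ)) (apply φ u) (apply φ v) (applyEdge φ e)
    pres u v e rewrite U′-apply u | U′-apply v = eq u v e

  -- A cycle begins and ends at the same vertex, so switching leaves its sign alone and only the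
  -- parity factor of `negate` remains.
  negating⇒weakAut : ∀ U (f : SignedIso Γ (switch U (negate Γ))) → WeakAut Γ (iso f)
  negating⇒weakAut U f = record
    { odd-cycles  = λ C odd → sym (begin
        opposite (cycleSign Γ C)                             ≡⟨ cong opposite (relation C) ⟩
        opposite (fold (image C) opposite (length (walk C))) ≡⟨ cong opposite (fold-opposite-odd _ odd _) ⟩
        opposite (opposite (image C))                        ≡⟨ Sign.opposite-involutive _ ⟩
        image C                                              ∎)
    ; even-cycles = λ C even → sym (trans (relation C) (fold-opposite-even even _))
    }
    where
    open ≡-Reasoning
    φ = iso f
    image : Cycle G → Sign
    image C = cycleSign Γ (applyCycle φ C)
    relation : ∀ C → cycleSign Γ C ≡ fold (image C) opposite (length (walk C))
    relation C = begin
      cycleSign Γ C                              ≡⟨ walkSign-iso f (walk C) ⟩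
      walkSign (switch U (negate Γ)) w           ≡⟨ walkSign-switch (negate Γ) U w ⟩
      flipIf (b xor b) (walkSign (negate Γ) w)   ≡⟨ cong (λ b → flipIf b (walkSign (negate Γ) w)) (xor-same b) ⟩
      walkSign (negate Γ) w                      ≡⟨ walkSign-negate Γ w ⟩
      fold (image C) opposite (length w)         ≡⟨ cong (fold (image C) opposite) (length-applyWalk φ (walk C)) ⟩
      fold (image C) opposite (length (walk C))  ∎
      where w = applyWalk φ (walk C)
            b = lookup U (apply φ (base C))

  walkSign-fixed : (φ : Aut G) → PowerIsId φ 1 → ∀ {u v} (w : Walk G u v) →
                   walkSign Γ (applyWalk φ w) ≡ walkSign Γ w
  walkSign-fixed φ fixed ε       = refl
  walkSign-fixed φ fixed (e ◅ w) =
    cong₂ Sign._*_ (σ-cong Γ _ e (fixed _) (fixed _)) (walkSign-fixed φ fixed w)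

  -- If `φ` fixed every vertex, an odd cycle would have a sign equal to its opposite. All cycles
  -- would then be even, against non-bipartiteness.
  weakAut-order≥2 : Connected G → ¬ Bipartite G → (φ : Aut G) → WeakAut Γ φ →
                    ∀ k → 0 < k → PowerIsId φ k → 2 ≤ k
  weakAut-order≥2 connected nonbip φ weak (suc zero) _ fixed =
    ⊥-elim (nonbipartite⇒oddCycle G connected nonbip λ C →
      decidable-stable (2 ∣? length (walk C)) λ odd →
        Sign.s≢opposite[s] (cycleSign Γ C)
          (trans (sym (walkSign-fixed φ fixed (walk C))) (WeakAut.odd-cycles weak C odd)))
  weakAut-order≥2 connected nonbip φ weak (suc (suc k)) _ _ = s≤s (s≤s z≤n)

-- Switching isomorphism

flipIf-twice : ∀ b s → flipIf b (flipIf b s) ≡ s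
flipIf-twice b s = trans (flipIf-xor b b s) (cong (λ b → flipIf b s) (xor-same b))

≃-sym : {G : Graph n} {H : Graph m} {Γ : SignedGraph G} {Δ : SignedGraph H} → Γ ≃ Δ → Δ ≃ Γ
≃-sym {G = G} {H} {Γ} {Δ} (U , f) = U′ , record
  { iso       = record { perm = flip π ; adj-pres = adj-back }
  ; sign-pres = λ x y e → back x y e _
  }
  where
  π = perm (iso f)
  U′ = tabulate (λ v → lookup U (π ⟨$⟩ʳ v))
  adj-back : ∀ x y → adj H x y ≡ adj G (π ⟨$⟩ˡ x) (π ⟨$⟩ˡ y)
  adj-back x y = sym (trans (adj-pres (iso f) _ _) (cong₂ (adj H) (inverseʳ π) (inverseʳ π)))
  U′-back : ∀ x → lookup U′ (π ⟨$⟩ˡ x) ≡ lookup U x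
  U′-back x = trans (lookup∘tabulate _ (π ⟨$⟩ˡ x)) (cong (lookup U) (inverseʳ π))
  back : ∀ x y e e′ → σ Δ x y e ≡ σ (switch U′ Γ) (π ⟨$⟩ˡ x) (π ⟨$⟩ˡ y) e′
  back x y e e′ rewrite U′-back x | U′-back y = sym (begin
    flipIf b (σ Γ (π ⟨$⟩ˡ x) (π ⟨$⟩ˡ y) e′)
      ≡⟨ cong (flipIf b) (sign-pres f _ _ e′) ⟩
    flipIf b (σ (switch U Δ) (π ⟨$⟩ʳ (π ⟨$⟩ˡ x)) (π ⟨$⟩ʳ (π ⟨$⟩ˡ y)) (applyEdge (iso f) e′))
      ≡⟨ cong (flipIf b) (σ-cong (switch U Δ) _ e (inverseʳ π) (inverseʳ π)) ⟩
    flipIf b (flipIf b (σ Δ x y e))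
      ≡⟨ flipIf-twice b _ ⟩
    σ Δ x y e ∎)
    where open ≡-Reasoning
          b = lookup U x xor lookup U y

≃-trans : {G : Graph n} {H : Graph m} {K : Graph k}
          {Γ : SignedGraph G} {Δ : SignedGraph H} {Θ : SignedGraph K} → Γ ≃ Δ → Δ ≃ Θ → Γ ≃ Θ
≃-trans {G = G} {H} {K} {Γ} {Δ} {Θ} (U , f) (W , g) = V , record
  { iso       = record { perm = perm (iso f) ∘ₚ perm (iso g)
                       ; adj-pres = λ u v → trans (adj-pres (iso f) u v) (adj-pres (iso g) _ _) }
  ; sign-pres = λ u v e → pres u v e _
  }
  where
  π = perm (iso g)
  -- Successive switchings amount to switching by the symmetric difference, after `U` has been
  -- carried to the vertices of `K`.
  V = tabulate (λ x → lookup U (π ⟨$⟩ˡ x) xor lookup W x)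
  F = apply (iso f)
  V-image : ∀ x → lookup V (π ⟨$⟩ʳ x) ≡ lookup U x xor lookup W (π ⟨$⟩ʳ x)
  V-image x = trans (lookup∘tabulate _ (π ⟨$⟩ʳ x))
                    (cong (λ y → lookup U y xor lookup W (π ⟨$⟩ʳ x)) (inverseˡ π))
  regroup : ∀ a b c d → (a xor b) xor (c xor d) ≡ (a xor c) xor (b xor d)
  regroup = solve 4 (λ a b c d → (a :+ b) :+ (c :+ d) := (a :+ c) :+ (b :+ d)) refl
    where open xor-∧-Solver
  pres : ∀ u v e e′ → σ Γ u v e ≡ σ (switch V Θ) (π ⟨$⟩ʳ F u) (π ⟨$⟩ʳ F v) e′
  pres u v e e′ rewrite V-image (F u) | V-image (F v) = begin
    σ Γ u v e
      ≡⟨ sign-pres f u v e ⟩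
    flipIf (a xor b) (σ Δ (F u) (F v) (applyEdge (iso f) e))
      ≡⟨ cong (flipIf (a xor b)) (sign-pres g _ _ _) ⟩
    flipIf (a xor b) (flipIf (c xor d) (σ Θ _ _ _))
      ≡⟨ flipIf-xor (a xor b) (c xor d) _ ⟩
    flipIf ((a xor b) xor (c xor d)) (σ Θ _ _ _)
      ≡⟨ cong₂ flipIf (regroup a b c d) (σ-cong Θ _ e′ refl refl) ⟩
    flipIf ((a xor c) xor (b xor d)) (σ Θ _ _ e′) ∎
    where open ≡-Reasoning
          a = lookup U (F u)
          b = lookup U (F v)
          c = lookup W (π ⟨$⟩ʳ F u)
          d = lookup W (π ⟨$⟩ʳ F v)

≃-negate : {G : Graph n} {H : Graph m} {Γ : SignedGraph G} {Δ : SignedGraph H} →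
           Γ ≃ Δ → negate Γ ≃ negate Δ
≃-negate (U , f) = U , record
  { iso       = iso f
  ; sign-pres = λ u v e → trans (cong opposite (sign-pres f u v e))
      (sym (flipIf-opposite (lookup U (apply (iso f) u) xor lookup U (apply (iso f) v)) _))
  }

-- Adjacency matrices

-- The effect on a matrix entry of negating the signed graph and then switching with bit `b`: the
-- value `true` undoes the negation.
negateUnless : Bool → ℤ → ℤ
negateUnless b z = if b then z else ℤ.- z

negateUnless-◃ : ∀ b s → negateUnless b (s ◃ 1) ≡ flipIf b (opposite s) ◃ 1
negateUnless-◃ false Sign.- = refl
negateUnless-◃ false Sign.+ = refl
negateUnless-◃ true  Sign.- = refl
negateUnless-◃ true  Sign.+ = refl

negateUnless-involutive : ∀ b z → negateUnless b (negateUnless b z) ≡ z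
negateUnless-involutive false z = ℤ.neg-involutive z
negateUnless-involutive true  z = refl

negateUnless-0 : ∀ b → negateUnless b 0ℤ ≡ 0ℤ
negateUnless-0 false = refl
negateUnless-0 true  = refl

◃1-injective : ∀ s t → s ◃ 1 ≡ t ◃ 1 → s ≡ t
◃1-injective Sign.- Sign.- _ = refl
◃1-injective Sign.+ Sign.+ _ = refl

◃1≢0 : ∀ s → s ◃ 1 ≢ 0ℤ
◃1≢0 Sign.- ()
◃1≢0 Sign.+ ()

module _ {G : Graph n} (Γ : SignedGraph G) where

  private A = adjacencyMatrix Γ

  adjacency-edge : ∀ {u v} (e : Edge G u v) → A u v ≡ σ Γ u v e ◃ 1
  adjacency-edge {u} {v} e with T? (adj G u v)
  ... | yes e′ = cong (λ e → σ Γ u v e ◃ 1) (T-irrelevant e′ e)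
  ... | no  ¬e = contradiction e ¬e

  adjacency-nonEdge : ∀ {u v} → ¬ Edge G u v → A u v ≡ 0ℤ
  adjacency-nonEdge {u} {v} ¬e with T? (adj G u v)
  ... | yes e = contradiction e ¬e
  ... | no  _ = refl

  edge-nonzero : ∀ {u v} → Edge G u v → A u v ≢ 0ℤ
  edge-nonzero e eq = ◃1≢0 _ (trans (sym (adjacency-edge e)) eq)

  nonzero⇒edge : ∀ {u v} → A u v ≢ 0ℤ → Edge G u v
  nonzero⇒edge nz = decidable-stable (T? _) λ ¬e → nz (adjacency-nonEdge ¬e)

  adjacency-entries : Entries01-1 A
  adjacency-entries u v with T? (adj G u v)
  ... | no _ = inj₁ refl
  ... | yes e with σ Γ u v e
  ...   | Sign.+ = inj₂ (inj₁ refl)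
  ...   | Sign.- = inj₂ (inj₂ refl)

  adjacency-sym : Symmetricᴹ A
  adjacency-sym u v with T? (adj G u v)
  ... | yes e = trans (cong (_◃ 1) (σ-sym Γ u v e e′)) (sym (adjacency-edge e′))
    where e′ = subst T (adj-sym G u v) e
  ... | no ¬e = sym (adjacency-nonEdge λ e → ¬e (subst T (adj-sym G v u) e))

  adjacency-diag : ZeroDiagonal A
  adjacency-diag v = adjacency-nonEdge (subst T (adj-irrefl G v))

  -- Matrix version of a `SignedIso` from `Γ` to `switch U (negate Γ)` along `π`. Zero entries mark
  -- the non-edges, so these equations encode preservation of adjacency as well as of signs.
  NegatesUpTo : Subset n → Permutation n n → Set
  NegatesUpTo U π = ∀ u v →
    A u v ≡ negateUnless (lookup U (π ⟨$⟩ʳ u) xor lookup U (π ⟨$⟩ʳ v)) (A (π ⟨$⟩ʳ u) (π ⟨$⟩ʳ v))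

  iso⇒negates : ∀ U (f : SignedIso Γ (switch U (negate Γ))) → NegatesUpTo U (perm (iso f))
  iso⇒negates U f u v with T? (adj G u v)
  ... | yes e = trans (cong (_◃ 1) (sign-pres f u v e))
                  (sym (trans (cong (negateUnless b) (adjacency-edge (applyEdge (iso f) e)))
                              (negateUnless-◃ b _)))
    where b = lookup U (apply (iso f) u) xor lookup U (apply (iso f) v)
  ... | no ¬e = sym (trans (cong (negateUnless b) (adjacency-nonEdge ¬e′)) (negateUnless-0 b))
    where b = lookup U (apply (iso f) u) xor lookup U (apply (iso f) v)
          ¬e′ : ¬ Edge G (apply (iso f) u) (apply (iso f) v)
          ¬e′ e = ¬e (subst T (sym (adj-pres (iso f) u v)) e)

  -- Edges are the nonzero entries, and `negateUnless` is an involution fixing zero, so adjacency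
  -- transfers in both directions. Signs are then recovered from nonzero entries.
  negates⇒iso : ∀ U π → NegatesUpTo U π →
                Σ (SignedIso Γ (switch U (negate Γ))) λ f → perm (iso f) ≡ π
  negates⇒iso U π negates = record
    { iso       = record { perm = π ; adj-pres = λ u v → adj-≡ (edge⇒ u v) (edge⇐ u v) }
    ; sign-pres = λ u v e → pres u v e _
    } , refl
    where
    bit : Fin n → Fin n → Bool
    bit u v = lookup U (π ⟨$⟩ʳ u) xor lookup U (π ⟨$⟩ʳ v)

    adj-≡ : ∀ {a b} → (T a → T b) → (T b → T a) → a ≡ b
    adj-≡ {false} {false} _ _ = refl
    adj-≡ {false} {true}  _ g = ⊥-elim (g _)
    adj-≡ {true}  {false} f _ = ⊥-elim (f _)
    adj-≡ {true}  {true}  _ _ = refl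

    edge⇒ : ∀ u v → Edge G u v → Edge G (π ⟨$⟩ʳ u) (π ⟨$⟩ʳ v)
    edge⇒ u v e = nonzero⇒edge λ eq → edge-nonzero e
      (trans (negates u v) (trans (cong (negateUnless (bit u v)) eq) (negateUnless-0 (bit u v))))

    edge⇐ : ∀ u v → Edge G (π ⟨$⟩ʳ u) (π ⟨$⟩ʳ v) → Edge G u v
    edge⇐ u v e = nonzero⇒edge λ eq → edge-nonzero e (begin
      A (π ⟨$⟩ʳ u) (π ⟨$⟩ʳ v)
        ≡⟨ negateUnless-involutive (bit u v) _ ⟨
      negateUnless (bit u v) (negateUnless (bit u v) (A (π ⟨$⟩ʳ u) (π ⟨$⟩ʳ v)))
        ≡⟨ cong (negateUnless (bit u v)) (trans (sym (negates u v)) eq) ⟩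
      negateUnless (bit u v) 0ℤ
        ≡⟨ negateUnless-0 (bit u v) ⟩
      0ℤ ∎)
      where open ≡-Reasoning

    pres : ∀ u v e e′ → σ Γ u v e ≡ σ (switch U (negate Γ)) (π ⟨$⟩ʳ u) (π ⟨$⟩ʳ v) e′
    pres u v e e′ = ◃1-injective _ _ (begin
      σ Γ u v e ◃ 1
        ≡⟨ adjacency-edge e ⟨
      A u v
        ≡⟨ negates u v ⟩
      negateUnless (bit u v) (A (π ⟨$⟩ʳ u) (π ⟨$⟩ʳ v))
        ≡⟨ cong (negateUnless (bit u v)) (adjacency-edge e′) ⟩
      negateUnless (bit u v) (σ Γ _ _ e′ ◃ 1)
        ≡⟨ negateUnless-◃ (bit u v) _ ⟩
      flipIf (bit u v) (opposite (σ Γ _ _ e′)) ◃ 1 ∎)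
      where open ≡-Reasoning

-- Exchanging the two halves of Fin (m + m)

halves-elim : ∀ {m} (P : Fin (m + m) → Set) →
              (∀ i → P (i ↑ˡ m)) → (∀ i → P (m ↑ʳ i)) → ∀ u → P u
halves-elim {m} P left right u with splitAt m u in eq
... | inj₁ i = subst P (Fin.splitAt⁻¹-↑ˡ eq) (left i)
... | inj₂ i = subst P (Fin.splitAt⁻¹-↑ʳ eq) (right i)

swapHalves : ∀ m → Permutation (m + m) (m + m)
swapHalves m = ↔-sym Fin.+↔⊎ ↔-∘ (⊎-comm (Fin m) (Fin m) ↔-∘ Fin.+↔⊎)

swapHalves-↑ˡ : ∀ {m} (i : Fin m) → swapHalves m ⟨$⟩ʳ (i ↑ˡ m) ≡ m ↑ʳ i
swapHalves-↑ˡ {m} i rewrite Fin.splitAt-↑ˡ m i m = refl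

swapHalves-↑ʳ : ∀ {m} (i : Fin m) → swapHalves m ⟨$⟩ʳ (m ↑ʳ i) ≡ i ↑ˡ m
swapHalves-↑ʳ {m} i rewrite Fin.splitAt-↑ʳ m m i = refl

swapHalves-involutive : ∀ {m} (u : Fin (m + m)) → swapHalves m ⟨$⟩ʳ (swapHalves m ⟨$⟩ʳ u) ≡ u
swapHalves-involutive {m} = halves-elim {m} _
  (λ i → trans (cong (swapHalves m ⟨$⟩ʳ_) (swapHalves-↑ˡ i)) (swapHalves-↑ʳ i))
  (λ i → trans (cong (swapHalves m ⟨$⟩ʳ_) (swapHalves-↑ʳ i)) (swapHalves-↑ˡ i))

↑ˡ≢↑ʳ : ∀ {m} (i j : Fin m) → i ↑ˡ m ≢ m ↑ʳ j
↑ˡ≢↑ʳ {m} i j eq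
  with () ← trans (sym (Fin.splitAt-↑ˡ m i m)) (trans (cong (splitAt m) eq) (Fin.splitAt-↑ʳ m m j))

swapHalves-moves : ∀ {m} (u : Fin (m + m)) → swapHalves m ⟨$⟩ʳ u ≢ u
swapHalves-moves {m} = halves-elim {m} _
  (λ i eq → ↑ˡ≢↑ʳ i i (trans (sym eq) (swapHalves-↑ˡ i)))
  (λ i eq → ↑ˡ≢↑ʳ i i (trans (sym (swapHalves-↑ʳ i)) eq))

-- Switching by the whole right half affects only the off-diagonal blocks; for `c = false` the set
-- is empty. Thus `c` governs just the relation between those two blocks.
rightHalf : ∀ {m} → Bool → Subset (m + m)
rightHalf {m} c = replicate m false Vec.++ replicate m c

lookup-rightHalf-↑ˡ : ∀ {m} c (i : Fin m) → lookup (rightHalf {m} c) (i ↑ˡ m) ≡ false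
lookup-rightHalf-↑ˡ {m} c i =
  trans (lookup-++ˡ (replicate m false) _ i) (lookup-replicate i false)

lookup-rightHalf-↑ʳ : ∀ {m} c (i : Fin m) → lookup (rightHalf {m} c) (m ↑ʳ i) ≡ c
lookup-rightHalf-↑ʳ {m} c i =
  trans (lookup-++ʳ (replicate m false) _ i) (lookup-replicate i c)

-- Block form

-- The lower blocks of M are determined by the upper ones as in Γᵃ (c = true) or Γᵇ (c = false).
record Blocks {m} (c : Bool) (M : Matrix (m + m)) : Set where
  field
    lower-right : ∀ i j → M (m ↑ʳ i) (m ↑ʳ j) ≡ ℤ.- M (i ↑ˡ m) (j ↑ˡ m)
    lower-left  : ∀ i j → M (m ↑ʳ i) (j ↑ˡ m) ≡ negateUnless c (M (i ↑ˡ m) (m ↑ʳ j))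

module _ {m} (A B C D : Matrix m) where

  private
    ↑ˡ-row : ∀ i → block A B C D (i ↑ˡ m) ≡ A i Functional.++ B i
    ↑ˡ-row = Functional.lookup-++ˡ (Functional.zipWith Functional._++_ A B) _

    ↑ʳ-row : ∀ i → block A B C D (m ↑ʳ i) ≡ C i Functional.++ D i
    ↑ʳ-row = Functional.lookup-++ʳ (Functional.zipWith Functional._++_ A B) _

  block-↑ˡ↑ˡ : ∀ i j → block A B C D (i ↑ˡ m) (j ↑ˡ m) ≡ A i j
  block-↑ˡ↑ˡ i j = trans (cong-app (↑ˡ-row i) _) (Functional.lookup-++ˡ (A i) (B i) j)

  block-↑ˡ↑ʳ : ∀ i j → block A B C D (i ↑ˡ m) (m ↑ʳ j) ≡ B i j
  block-↑ˡ↑ʳ i j = trans (cong-app (↑ˡ-row i) _) (Functional.lookup-++ʳ (A i) (B i) j)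

  block-↑ʳ↑ˡ : ∀ i j → block A B C D (m ↑ʳ i) (j ↑ˡ m) ≡ C i j
  block-↑ʳ↑ˡ i j = trans (cong-app (↑ʳ-row i) _) (Functional.lookup-++ˡ (C i) (D i) j)

  block-↑ʳ↑ʳ : ∀ i j → block A B C D (m ↑ʳ i) (m ↑ʳ j) ≡ D i j
  block-↑ʳ↑ʳ i j = trans (cong-app (↑ʳ-row i) _) (Functional.lookup-++ʳ (C i) (D i) j)

  block-unique : {M : Matrix (m + m)} →
                 (∀ i j → M (i ↑ˡ m) (j ↑ˡ m) ≡ A i j) → (∀ i j → M (i ↑ˡ m) (m ↑ʳ j) ≡ B i j) →
                 (∀ i j → M (m ↑ʳ i) (j ↑ˡ m) ≡ C i j) → (∀ i j → M (m ↑ʳ i) (m ↑ʳ j) ≡ D i j) →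
                 M ≋ block A B C D
  block-unique a b c d = halves-elim {m} _
    (λ i → halves-elim {m} _ (λ j → trans (a i j) (sym (block-↑ˡ↑ˡ i j)))
                             (λ j → trans (b i j) (sym (block-↑ˡ↑ʳ i j))))
    (λ i → halves-elim {m} _ (λ j → trans (c i j) (sym (block-↑ʳ↑ˡ i j)))
                             (λ j → trans (d i j) (sym (block-↑ʳ↑ʳ i j))))

-- With the lower left block written through `negateUnless c`, the hypothesis computes to the `form`
-- field of `Formᵃ` at `true` and of `Formᵇ` at `false`.
block⇒Blocks : ∀ {m} c {M : Matrix (m + m)} (B X : Matrix m) →
               M ≋ block B X (λ i j → negateUnless c (X i j)) (-ᴹ B) → Blocks {m} c M
block⇒Blocks {m} c B X form = record
  { lower-right = λ i j → trans (trans (form _ _) (block-↑ʳ↑ʳ B X C D i j))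
      (cong ℤ.-_ (sym (trans (form _ _) (block-↑ˡ↑ˡ B X C D i j))))
  ; lower-left  = λ i j → trans (trans (form _ _) (block-↑ʳ↑ˡ B X C D i j))
      (cong (negateUnless c) (sym (trans (form _ _) (block-↑ˡ↑ʳ B X C D i j))))
  }
  where
  C D : Matrix m
  C i j = negateUnless c (X i j)
  D = -ᴹ B

module _ {m} {H : Graph (m + m)} (Γ : SignedGraph H) where

  private A = adjacencyMatrix Γ

  -- Two vertices in the same half have equal bits, giving plain negation; in different halves the
  -- bits sum to `c`. Two of the four cases are the fields of `Blocks`, the other two are these read
  -- backwards.
  Blocks⇒negates : ∀ c → Blocks {m} c A → NegatesUpTo Γ (rightHalf {m} c) (swapHalves m)
  Blocks⇒negates c blocks = halves-elim {m} _
    (λ i → halves-elim {m} _ (λ j → at (swapHalves-↑ˡ i) (swapHalves-↑ˡ j) (ll i j))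
                             (λ j → at (swapHalves-↑ˡ i) (swapHalves-↑ʳ j) (lr i j)))
    (λ i → halves-elim {m} _ (λ j → at (swapHalves-↑ʳ i) (swapHalves-↑ˡ j) (rl i j))
                             (λ j → at (swapHalves-↑ʳ i) (swapHalves-↑ʳ j) (rr i j)))
    where
    open Blocks blocks
    Q = rightHalf {m} c
    At : Fin (m + m) → Fin (m + m) → Fin (m + m) → Fin (m + m) → Set
    At u v x y = A u v ≡ negateUnless (lookup Q x xor lookup Q y) (A x y)
    at : ∀ {u v x y x′ y′} → x ≡ x′ → y ≡ y′ → At u v x′ y′ → At u v x y
    at refl refl eq = eq
    ll : ∀ i j → At (i ↑ˡ m) (j ↑ˡ m) (m ↑ʳ i) (m ↑ʳ j)
    ll i j rewrite lookup-rightHalf-↑ʳ {m} c i | lookup-rightHalf-↑ʳ {m} c j | xor-same c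
      | lower-right i j = sym (ℤ.neg-involutive _)
    lr : ∀ i j → At (i ↑ˡ m) (m ↑ʳ j) (m ↑ʳ i) (j ↑ˡ m)
    lr i j rewrite lookup-rightHalf-↑ʳ {m} c i | lookup-rightHalf-↑ˡ {m} c j | xor-identityʳ c
      | lower-left i j = sym (negateUnless-involutive c _)
    rl : ∀ i j → At (m ↑ʳ i) (j ↑ˡ m) (i ↑ˡ m) (m ↑ʳ j)
    rl i j rewrite lookup-rightHalf-↑ˡ {m} c i | lookup-rightHalf-↑ʳ {m} c j = lower-left i j
    rr : ∀ i j → At (m ↑ʳ i) (m ↑ʳ j) (i ↑ˡ m) (j ↑ˡ m)
    rr i j rewrite lookup-rightHalf-↑ˡ {m} c i | lookup-rightHalf-↑ˡ {m} c j = lower-right i j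

  negates⇒Blocks : ∀ c → NegatesUpTo Γ (rightHalf {m} c) (swapHalves m) → Blocks {m} c A
  negates⇒Blocks c negates = record { lower-right = rr ; lower-left = rl }
    where
    rr : ∀ i j → A (m ↑ʳ i) (m ↑ʳ j) ≡ ℤ.- A (i ↑ˡ m) (j ↑ˡ m)
    rr i j with eq ← negates (m ↑ʳ i) (m ↑ʳ j)
      rewrite swapHalves-↑ʳ i | swapHalves-↑ʳ j
            | lookup-rightHalf-↑ˡ {m} c i | lookup-rightHalf-↑ˡ {m} c j = eq
    rl : ∀ i j → A (m ↑ʳ i) (j ↑ˡ m) ≡ negateUnless c (A (i ↑ˡ m) (m ↑ʳ j))
    rl i j with eq ← negates (m ↑ʳ i) (j ↑ˡ m)
      rewrite swapHalves-↑ʳ i | swapHalves-↑ˡ j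
            | lookup-rightHalf-↑ˡ {m} c i | lookup-rightHalf-↑ʳ {m} c j = eq

  private
    B X : Matrix m
    B i j = A (i ↑ˡ m) (j ↑ˡ m)
    X i j = A (i ↑ˡ m) (m ↑ʳ j)

    -- Symmetry of `A` moves an entry to the lower left block, and `lower-left` brings it back
    -- transposed. This makes `X` symmetric for `c = true` and skew for `c = false`.
    upper-right-transpose : ∀ c → Blocks {m} c A → ∀ i j → X i j ≡ negateUnless c (X j i)
    upper-right-transpose c blocks i j =
      trans (adjacency-sym Γ (i ↑ˡ m) (m ↑ʳ j)) (Blocks.lower-left blocks j i)

  Blocks⇒Formᵃ : Blocks {m} true A → Formᵃ {m} Γ
  Blocks⇒Formᵃ blocks = record
    { B         = B
    ; X         = X
    ; B-entries = λ _ _ → adjacency-entries Γ _ _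
    ; X-entries = λ _ _ → adjacency-entries Γ _ _
    ; B-sym     = λ _ _ → adjacency-sym Γ _ _
    ; B-diag    = λ _ → adjacency-diag Γ _
    ; X-sym     = upper-right-transpose true blocks
    ; form      = block-unique B X _ (-ᴹ B) (λ _ _ → refl) (λ _ _ → refl) lower-left lower-right
    }
    where open Blocks blocks

  Blocks⇒Formᵇ : Blocks {m} false A → Formᵇ {m} Γ
  Blocks⇒Formᵇ blocks = record
    { B         = B
    ; Y         = X
    ; B-entries = λ _ _ → adjacency-entries Γ _ _
    ; Y-entries = λ _ _ → adjacency-entries Γ _ _
    ; B-sym     = λ _ _ → adjacency-sym Γ _ _
    ; B-diag    = λ _ → adjacency-diag Γ _
    ; Y-skew    = upper-right-transpose false blocks
    ; form      = block-unique B X _ (-ᴹ B) (λ _ _ → refl) (λ _ _ → refl) lower-left lower-right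
    }
    where open Blocks blocks

-- Fixed-point-free involutions as exchanges of halves

lookup-injective : ∀ {a} {A : Set a} {xs : List A} → Unique xs → ∀ i j →
                   List.lookup xs i ≡ List.lookup xs j → i ≡ j
lookup-injective {xs = _ ∷ _} _ zero zero _ = refl
lookup-injective {xs = _ ∷ _} (x∉xs ∷ _) zero (suc j) eq =
  contradiction eq (All.lookup x∉xs (∈-lookup j))
lookup-injective {xs = _ ∷ _} (x∉xs ∷ _) (suc i) zero eq =
  contradiction (sym eq) (All.lookup x∉xs (∈-lookup i))
lookup-injective {xs = _ ∷ _} (_ ∷ unique) (suc i) (suc j) eq =
  cong suc (lookup-injective unique i j eq)

module _ (f : Fin n → Fin n) (f-involutive : ∀ v → f (f v) ≡ v) (f-moves : ∀ v → f v ≢ v) where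

  private
    lower? : ∀ v → Dec (v Fin.< f v)
    lower? v = v Fin.<? f v

    -- The smaller vertex of each orbit: as `f` moves every vertex, exactly one of `v` and `f v` is
    -- listed.
    representatives : List (Fin n)
    representatives = List.filter lower? (List.allFin n)

    h : ℕ
    h = List.length representatives

    rep : Fin h → Fin n
    rep = List.lookup representatives

    rep-lower : ∀ i → rep i Fin.< f (rep i)
    rep-lower i = proj₂ (∈-filter⁻ lower? {xs = List.allFin n} (∈-lookup i))

    rep-injective : ∀ {i j} → rep i ≡ rep j → i ≡ j
    rep-injective = lookup-injective (filter⁺ lower? (allFin⁺ n)) _ _

    rep-index : ∀ v → v Fin.< f v → ∃ λ i → rep i ≡ v
    rep-index v v<fv = Any.index v∈ , sym (lookup-index v∈)
      where v∈ = ∈-filter⁺ lower? (∈-allFin v) v<fv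

    to : Fin (h + h) → Fin n
    to u = Sum.[ rep , (λ i → f (rep i)) ] (splitAt h u)

    to-↑ˡ : ∀ i → to (i ↑ˡ h) ≡ rep i
    to-↑ˡ i = cong Sum.[ rep , _ ] (Fin.splitAt-↑ˡ h i h)

    to-↑ʳ : ∀ i → to (h ↑ʳ i) ≡ f (rep i)
    to-↑ʳ i = cong Sum.[ rep , _ ] (Fin.splitAt-↑ʳ h h i)

    preimage : ∀ v → ∃ λ u → to u ≡ v
    preimage v with Fin.<-cmp v (f v)
    ... | tri< v<fv _ _ with i , eq ← rep-index v v<fv = i ↑ˡ h , trans (to-↑ˡ i) eq
    ... | tri≈ _ v≡fv _ = contradiction (sym v≡fv) (f-moves v)
    -- The larger vertex of an orbit is the image of the representative `f v`, so it lies in the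
    -- right half.
    ... | tri> _ _ fv<v
      with i , eq ← rep-index (f v) (subst (f v Fin.<_) (sym (f-involutive v)) fv<v) =
      h ↑ʳ i , trans (to-↑ʳ i) (trans (cong f eq) (f-involutive v))

    -- An equality would make `rep i` and `rep j` the two vertices of one orbit, each smaller than
    -- the other.
    rep≢f-rep : ∀ i j → rep i ≢ f (rep j)
    rep≢f-rep i j eq = Fin.<-asym (rep-lower j)
      (subst₂ Fin._<_ eq (trans (cong f eq) (f-involutive (rep j))) (rep-lower i))

    to-injective : ∀ u v → to u ≡ to v → u ≡ v
    to-injective = halves-elim {h} _
      (λ i → halves-elim {h} _
        (λ j eq → cong (_↑ˡ h) (rep-injective (trans (sym (to-↑ˡ i)) (trans eq (to-↑ˡ j)))))
        (λ j eq → contradiction (trans (sym (to-↑ˡ i)) (trans eq (to-↑ʳ j))) (rep≢f-rep i j)))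
      (λ i → halves-elim {h} _
        (λ j eq → contradiction (trans (sym (to-↑ˡ j)) (trans (sym eq) (to-↑ʳ i))) (rep≢f-rep j i))
        (λ j eq → cong (h ↑ʳ_) (rep-injective (f-injective
          (trans (sym (to-↑ʳ i)) (trans eq (to-↑ʳ j)))))))
      where
      f-injective : ∀ {v w} → f v ≡ f w → v ≡ w
      f-injective eq = trans (sym (f-involutive _)) (trans (cong f eq) (f-involutive _))

  -- Representatives fill the left half and their images the right half in the same order, so
  -- exchanging the halves is applying `f`.
  involution⇒swapHalves : ∃ λ m → Σ (Permutation (m + m) n) λ π →
                          ∀ u → π ⟨$⟩ʳ (swapHalves m ⟨$⟩ʳ u) ≡ f (π ⟨$⟩ʳ u)
  involution⇒swapHalves = h , π , halves-elim {h} _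
    (λ i → trans (cong to (swapHalves-↑ˡ i)) (trans (to-↑ʳ i) (cong f (sym (to-↑ˡ i)))))
    (λ i → trans (cong to (swapHalves-↑ʳ i)) (trans (to-↑ˡ i)
             (trans (sym (f-involutive (rep i))) (cong f (sym (to-↑ʳ i))))))
    where
    π : Permutation (h + h) n
    π = permutation to (λ v → proj₁ (preimage v)) (λ v → proj₂ (preimage v))
          (λ u → to-injective _ u (proj₂ (preimage (to u))))

-- Negating involutions

-- Applying the negating involution twice shows that U u xor U (φ u) is the same at both ends of
-- every edge.
negating-involution-constant :
  {G : Graph n} {Γ : SignedGraph G} → Connected G →
  ∀ U (f : SignedIso Γ (switch U (negate Γ))) → (∀ v → apply (iso f) (apply (iso f) v) ≡ v) →
  ∃ λ c → ∀ v → lookup U v xor lookup U (apply (iso f) v) ≡ c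
-- With no vertex to read the constant from, `false` is an arbitrary choice.
negating-involution-constant {zero}          connected U f involutive = false , λ ()
negating-involution-constant {suc n} {G} {Γ} connected U f involutive =
  t zero , λ v → along (connected v zero)
  where
  φ = apply (iso f)
  t : Fin (suc n) → Bool
  t v = lookup U v xor lookup U (φ v)

  flipIf-fixed : ∀ b s → s ≡ flipIf b s → b ≡ false
  flipIf-fixed false s      _ = refl
  flipIf-fixed true  Sign.- ()
  flipIf-fixed true  Sign.+ ()

  xor-false⇒≡ : ∀ a b → a xor b ≡ false → a ≡ b
  xor-false⇒≡ false b     eq = sym eq
  xor-false⇒≡ true  true  eq = refl

  regroup : ∀ a b c d → (a xor b) xor (c xor d) ≡ (c xor a) xor (d xor b)
  regroup = solve 4 (λ a b c d → (a :+ b) :+ (c :+ d) := (c :+ a) :+ (d :+ b)) refl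
    where open xor-∧-Solver

  -- Going around twice, the two negations cancel; the four remaining switching bits, grouped by
  -- vertex orbit, give `t u xor t v`.
  σ-twice : ∀ u v (e : Edge G u v) → σ Γ u v e ≡ flipIf (t u xor t v) (σ Γ u v e)
  σ-twice u v e = begin
    σ Γ u v e
      ≡⟨ sign-pres f u v e ⟩
    flipIf φφ (opposite (σ Γ (φ u) (φ v) e′))
      ≡⟨ cong (λ s → flipIf φφ (opposite s)) (trans (sign-pres f (φ u) (φ v) e′)
           (σ-cong (switch U (negate Γ)) _ e (involutive u) (involutive v))) ⟩
    flipIf φφ (opposite (flipIf idid (opposite (σ Γ u v e))))
      ≡⟨ cong (flipIf φφ) (flipIf-opposite idid _) ⟨
    flipIf φφ (flipIf idid (opposite (opposite (σ Γ u v e))))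
      ≡⟨ flipIf-xor φφ idid _ ⟩
    flipIf (φφ xor idid) (opposite (opposite (σ Γ u v e)))
      ≡⟨ cong₂ flipIf (regroup (lookup U (φ u)) (lookup U (φ v)) (lookup U u) (lookup U v))
                      (Sign.opposite-involutive _) ⟩
    flipIf (t u xor t v) (σ Γ u v e) ∎
    where
    open ≡-Reasoning
    e′ = applyEdge (iso f) e
    φφ = lookup U (φ u) xor lookup U (φ v)
    idid = lookup U u xor lookup U v

  along : ∀ {u v} → Walk G u v → t u ≡ t v
  along ε                        = refl
  along (_◅_ {i = u} {j = v} e w) =
    trans (xor-false⇒≡ (t u) (t v) (flipIf-fixed _ _ (σ-twice u v e))) (along w)

switch-iso : {G : Graph n} {H : Graph m} (φ : GraphIso G H) (Γ : SignedGraph H) (R : Subset n) →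
             switch R (pullback φ Γ) ≃ Γ
switch-iso φ Γ R = W , record { iso = φ ; sign-pres = pres }
  where
  W = tabulate (λ v → lookup R (perm φ ⟨$⟩ˡ v))
  W-apply : ∀ u → lookup W (apply φ u) ≡ lookup R u
  W-apply u = trans (lookup∘tabulate _ (apply φ u)) (cong (lookup R) (inverseˡ (perm φ)))
  pres : ∀ u v e → σ (switch R (pullback φ Γ)) u v e ≡
                   σ (switch W Γ) (apply φ u) (apply φ v) (applyEdge φ e)
  pres u v e rewrite W-apply u | W-apply v = refl

module _ {G : Graph n} {Γ : SignedGraph G} (connected : Connected G) where

  -- `H` is `G` relabelled so that the involution exchanges the halves. Switching by `R` then
  -- reduces the switching set of the involution from `U` to `rightHalf c`.
  negating-involution⇒Blocks :
    ∀ U (f : SignedIso Γ (switch U (negate Γ))) →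
    (∀ v → apply (iso f) (apply (iso f) v) ≡ v) → (∀ v → apply (iso f) v ≢ v) →
    ∃ λ c → ∃ λ m → Σ (Graph (m + m)) λ H → Σ (SignedGraph H) λ Δ →
      Blocks {m} c (adjacencyMatrix Δ) × Γ ≃ Δ
  negating-involution⇒Blocks U f involutive moves
    with negating-involution-constant connected U f involutive
       | involution⇒swapHalves (apply (iso f)) involutive moves
  ... | c , constant | m , π , π-swap =
    c , m , H , Δ , negates⇒Blocks Δ c (iso⇒negates Δ Q g) ,
    ≃-sym (switch-iso ι Γ R)
    where
    φ = apply (iso f)
    p = π ⟨$⟩ʳ_
    s = swapHalves m ⟨$⟩ʳ_

    H : Graph (m + m)
    H = record
      { adj        = λ u v → adj G (p u) (p v)
      ; adj-sym    = λ u v → adj-sym G (p u) (p v)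
      ; adj-irrefl = λ v → adj-irrefl G (p v)
      }

    ι : GraphIso H G
    ι = record { perm = π ; adj-pres = λ _ _ → refl }

    -- With `R` and `Q` false on the left half, `Q-relation` at a right vertex forces the bit of `R`
    -- there to be that of `U` at its left partner. At a left vertex the relation then reduces to
    -- `constant′`.
    R Q : Subset (m + m)
    R = replicate m false Vec.++ tabulate (λ i → lookup U (p (i ↑ˡ m)))
    Q = rightHalf {m} c

    Δ : SignedGraph H
    Δ = switch R (pullback ι Γ)

    R-↑ˡ : ∀ i → lookup R (i ↑ˡ m) ≡ false
    R-↑ˡ i = trans (lookup-++ˡ (replicate m false) _ i) (lookup-replicate i false)

    R-↑ʳ : ∀ i → lookup R (m ↑ʳ i) ≡ lookup U (p (i ↑ˡ m))
    R-↑ʳ i = trans (lookup-++ʳ (replicate m false) _ i) (lookup∘tabulate _ i)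

    constant′ : ∀ i → lookup U (p (i ↑ˡ m)) xor lookup U (p (m ↑ʳ i)) ≡ c
    constant′ i = trans
      (cong (λ v → lookup U (p (i ↑ˡ m)) xor lookup U v)
            (trans (cong p (sym (swapHalves-↑ˡ i))) (π-swap (i ↑ˡ m))))
      (constant (p (i ↑ˡ m)))

    -- The condition at a single vertex for `g` to exist: adding it over both ends of an edge yields
    -- the equality of switching bits used in `pres`.
    Q-relation : ∀ u → lookup R u xor lookup U (p (s u)) ≡ lookup Q (s u) xor lookup R (s u)
    Q-relation = halves-elim {m} _
      (λ i → subst (Related (i ↑ˡ m)) (sym (swapHalves-↑ˡ i)) (left i))
      (λ i → subst (Related (m ↑ʳ i)) (sym (swapHalves-↑ʳ i)) (right i))
      where
      Related : Fin (m + m) → Fin (m + m) → Set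
      Related u v = lookup R u xor lookup U (p v) ≡ lookup Q v xor lookup R v
      cancel : ∀ a b → b ≡ (a xor b) xor a
      cancel = solve 2 (λ a b → b := (a :+ b) :+ a) refl
        where open xor-∧-Solver
      left : ∀ i → Related (i ↑ˡ m) (m ↑ʳ i)
      left i rewrite lookup-rightHalf-↑ʳ {m} c i | R-↑ˡ i | R-↑ʳ i =
        trans (cancel (lookup U (p (i ↑ˡ m))) _) (cong (_xor lookup U (p (i ↑ˡ m))) (constant′ i))
      right : ∀ i → Related (m ↑ʳ i) (i ↑ˡ m)
      right i rewrite lookup-rightHalf-↑ˡ {m} c i | R-↑ˡ i | R-↑ʳ i =
        xor-same (lookup U (p (i ↑ˡ m)))

    g : SignedIso Δ (switch Q (negate Δ))
    g = record
      { iso       = record { perm = swapHalves m ; adj-pres = s-adj }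
      ; sign-pres = λ u v e → pres u v e _
      }
      where
      s-adj : ∀ u v → adj H u v ≡ adj H (s u) (s v)
      s-adj u v = trans (adj-pres (iso f) (p u) (p v))
                        (sym (cong₂ (adj G) (π-swap u) (π-swap v)))

      regroup : ∀ a b a′ b′ x y x′ y′ → a xor x ≡ a′ xor x′ → b xor y ≡ b′ xor y′ →
                (a xor b) xor (x xor y) ≡ (a′ xor b′) xor (x′ xor y′)
      regroup a b a′ b′ x y x′ y′ eq eq′ =
        trans (interchange a b x y) (trans (cong₂ _xor_ eq eq′) (sym (interchange a′ b′ x′ y′)))
        where
        open xor-∧-Solver
        interchange : ∀ a b x y → (a xor b) xor (x xor y) ≡ (a xor x) xor (b xor y)
        interchange = solve 4 (λ a b x y → (a :+ b) :+ (x :+ y) := (a :+ x) :+ (b :+ y)) refl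

      pres : ∀ u v e e′ → σ Δ u v e ≡ σ (switch Q (negate Δ)) (s u) (s v) e′
      pres u v e e′ = begin
        flipIf r (σ Γ (p u) (p v) e)
          ≡⟨ cong (flipIf r) (sign-pres f (p u) (p v) e) ⟩
        flipIf r (σ (switch U (negate Γ)) (φ (p u)) (φ (p v)) _)
          ≡⟨ cong (flipIf r)
               (σ-cong (switch U (negate Γ)) _ e′ (sym (π-swap u)) (sym (π-swap v))) ⟩
        flipIf r (flipIf x (opposite z))
          ≡⟨ flipIf-xor r x _ ⟩
        flipIf (r xor x) (opposite z)
          ≡⟨ cong (λ b → flipIf b (opposite z))
               (regroup (lookup R u) (lookup R v) (lookup Q (s u)) (lookup Q (s v))
                        _ _ _ _ (Q-relation u) (Q-relation v)) ⟩
        flipIf (q xor r′) (opposite z)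
          ≡⟨ flipIf-xor q r′ _ ⟨
        flipIf q (flipIf r′ (opposite z))
          ≡⟨ cong (flipIf q) (flipIf-opposite r′ z) ⟩
        flipIf q (opposite (flipIf r′ z)) ∎
        where
        open ≡-Reasoning
        r = lookup R u xor lookup R v
        r′ = lookup R (s u) xor lookup R (s v)
        q = lookup Q (s u) xor lookup Q (s v)
        x = lookup U (p (s u)) xor lookup U (p (s v))
        z = σ Γ (p (s u)) (p (s v)) e′

  -- Every weak automorphism has order at least two here, and an involution attains this bound; that
  -- gives both its order and its principality.
  negating-involution⇒ℕ𝔽𝕊₁ :
    ¬ Bipartite G → ((U , f) : Γ ≃ negate Γ) →
    (∀ v → apply (iso f) (apply (iso f) v) ≡ v) → (∀ v → apply (iso f) v ≢ v) → Γ ∈ ℕ𝔽𝕊₁ G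
  negating-involution⇒ℕ𝔽𝕊₁ nonbip (U , f) involutive moves =
    (U , f) , iso f ,
    record
      { weak     = weak
      ; smallest = λ ψ ψ-weak k l order-φ order-ψ →
          ≤-trans (HasOrder.least order-φ 2 (s≤s z≤n) involutive)
                  (weakAut-order≥2 Γ connected nonbip ψ ψ-weak l
                    (HasOrder.positive order-ψ) (HasOrder.power order-ψ))
      } ,
    record
      { positive = s≤s z≤n
      ; power    = involutive
      ; least    = weakAut-order≥2 Γ connected nonbip (iso f) weak
      } ,
    moves
    where weak = negating⇒weakAut Γ U f

  -- The exchange of halves is a negating automorphism of `Δ`. Conjugating it by the isomorphism
  -- underlying `Γ ≃ Δ` gives one of `Γ`, through the chain from `Γ` to `Δ`, `negate Δ` and
  -- `negate Γ`.
  Blocks⇒ℕ𝔽𝕊₁ : ¬ Bipartite G → ∀ {m} c {H : Graph (m + m)} {Δ : SignedGraph H} →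
                 Blocks {m} c (adjacencyMatrix Δ) → Γ ≃ Δ → Γ ∈ ℕ𝔽𝕊₁ G
  Blocks⇒ℕ𝔽𝕊₁ nonbip {m} c {H} {Δ} blocks Γ≃Δ@(_ , f)
    with negates⇒iso Δ (rightHalf {m} c) (swapHalves m) (Blocks⇒negates Δ c blocks)
  ... | g , refl = negating-involution⇒ℕ𝔽𝕊₁ nonbip
    (≃-trans {Δ = Δ} {Θ = negate Γ} Γ≃Δ
      (≃-trans {Δ = negate Δ} {Θ = negate Γ} (rightHalf {m} c , g)
        (≃-sym {Γ = negate Γ} {Δ = negate Δ} (≃-negate {Γ = Γ} {Δ = Δ} Γ≃Δ))))
    -- In the square of the conjugate the inner `π` and its inverse cancel, leaving the square of
    -- `swapHalves m`.
    (λ v → trans (cong (λ x → π ⟨$⟩ˡ (swapHalves m ⟨$⟩ʳ x)) (inverseʳ π))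
          (trans (cong (π ⟨$⟩ˡ_) (swapHalves-involutive {m} (π ⟨$⟩ʳ v))) (inverseˡ π)))
    (λ v eq → swapHalves-moves {m} (π ⟨$⟩ʳ v) (trans (sym (inverseʳ π)) (cong (π ⟨$⟩ʳ_) eq)))
    where π = perm (iso f)

theorem4p1 : ∀ {n : ℕ} (G : Graph n) (Γ : SignedGraph G) →
    Connected G → ¬ Bipartite G →
    Γ ∈ ℕ𝔽𝕊₁ G ⇔
    ( (Σ ℕ λ m → Σ (Graph (m + m)) λ H → Σ (SignedGraph H) λ Γᵃ →
    Formᵃ {m} Γᵃ × Γ ≃ Γᵃ)
    ⊎ (Σ ℕ λ m → Σ (Graph (m + m)) λ H → Σ (SignedGraph H) λ Γᵇ →
    Formᵇ {m} Γᵇ × Γ ≃ Γᵇ) )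
theorem4p1 G Γ connected nonbip = mk⇔ to from
  where
  to : _ → _
  to (_ , φ , principal , order , moves)
    with weakAut⇒negating Γ connected φ (Principal.weak principal)
  ... | U , f , refl
    -- `fold v (apply φ) 2` computes to two applications of `φ`, so `power` is the involutivity
    -- required.
    with negating-involution⇒Blocks connected U f (HasOrder.power order) moves
  ...   | true  , m , H , Δ , blocks , Γ≃Δ = inj₁ (m , H , Δ , Blocks⇒Formᵃ Δ blocks , Γ≃Δ)
  ...   | false , m , H , Δ , blocks , Γ≃Δ = inj₂ (m , H , Δ , Blocks⇒Formᵇ Δ blocks , Γ≃Δ)
  from : _ → _
  from (inj₁ (m , H , Δ , formᵃ , Γ≃Δ)) =
    Blocks⇒ℕ𝔽𝕊₁ connected nonbip true (block⇒Blocks true B X form) Γ≃Δ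
    where open Formᵃ formᵃ
  from (inj₂ (m , H , Δ , formᵇ , Γ≃Δ)) =
    Blocks⇒ℕ𝔽𝕊₁ connected nonbip false (block⇒Blocks false B Y form) Γ≃Δ
    where open Formᵇ formᵇ
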